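{- Let $G$ be a simple, undirected, connected graph on $N$ vertices with edge set $E$ and degree sequence $d_1\le d_2\le\cdots\le d_N$. Then $$R^+(G)\ge N(N-4)+2|E|\sum_{j=1}^N\frac{1}{d_j}.$$
   Context: For vertices $i,j$ of $G$, $R_{ij}$ denotes the effective resistance between $i$ and $j$ when every edge of $G$ is a unit resistor. The additive degree-Kirchhoff index is $R^+(G)=\sum_{i<j}(d_i+d_j)R_{ij}$, where $d_i$ is the degree of vertex $i$. -}

module Defs where

open import Data.Fin.Base using (Fin; zero; suc; punchIn; punchOut)
import Data.Fin.Base as Fin
open import Data.Fin.Permutation using (Permutation′; _⟨$⟩ʳ_)
open import Data.Fin.Properties using (any?; punchIn-punchOut; _<?_)
  renaming (_≟_ to _≟ᶠ_)
import Data.Integer.Base as ℤ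
open import Data.Nat.Base as ℕ using (ℕ; zero; suc)
import Data.Nat.Properties as ℕ
open import Data.Product.Base using (∃; _×_; _,_; proj₁; proj₂)
open import Data.Rational.Base as ℚ hiding (∣_∣)
open import Data.Rational.Properties hiding (_<?_)
open import Data.Rational.Solver using (module +-*-Solver)
open import Data.Sum.Base using (_⊎_; inj₁; inj₂)
open import Algebra.Bundles using (CommutativeRing)
open import Level using (0ℓ)
open import Function.Base using (_∘_)
open import Relation.Binary.Core using (Rel)
open import Relation.Binary.Construct.Closure.ReflexiveTransitive using (Star; ε; _◅_)
import Relation.Binary.Definitions as B
open import Relation.Binary.PropositionalEquality
open import Relation.Nullary.Decidable using (Dec; yes; no; ¬?; _×-dec_)
open import Relation.Nullary.Negation using (¬_; contradiction)

open import Algebra.Properties.CommutativeMonoid.Sum ℕ.+-0-commutativeMonoid public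
  using () renaming (sum to sumℕ)
open import Algebra.Properties.Semiring.Sum
  (CommutativeRing.semiring +-*-commutativeRing) public
  using (sum; sum-syntax)
open import Algebra.Properties.Semiring.Sum
  (CommutativeRing.semiring +-*-commutativeRing)
  using (sum-cong-≗; sum-replicate-zero; ∑-distrib-+; ∑-comm; *-distribˡ-sum)

private
  variable
    n : ℕ

fromℕ : ℕ → ℚ
fromℕ m = ℤ.+ m / 1

-- The convention 1/0 = 0 only matters for the one-vertex graph: in a
-- connected graph on at least two vertices every degree is positive.
reciprocal : ℕ → ℚ
reciprocal zero    = 0ℚ
reciprocal (suc m) = ℤ.+ 1 / suc m

-- Iverson bracket.
𝟙 : ∀ {p} {P : Set p} → Dec P → ℕ
𝟙 (yes _) = 1
𝟙 (no _)  = 0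

record SimpleGraph (n : ℕ) : Set₁ where
  field
    Adj    : Rel (Fin n) 0ℓ
    adj?   : B.Decidable Adj
    symm   : B.Symmetric Adj
    irrefl : ∀ {i} → ¬ Adj i i

  degree : Fin n → ℕ
  degree i = sumℕ λ j → 𝟙 (adj? i j)

  ∣E∣ : ℕ
  ∣E∣ = sumℕ λ i → sumℕ λ j → 𝟙 (i <? j ×-dec adj? i j)

  Connected : Set
  Connected = ∀ i j → Star Adj i j

  IsDegreeSequence : (Fin n → ℕ) → Set
  IsDegreeSequence d =
    (∀ {i j} → i Fin.≤ j → d i ℕ.≤ d j) ×
    ∃ λ (π : Permutation′ n) → ∀ j → d j ≡ degree (π ⟨$⟩ʳ j)

  -- Unit conductances are rational, so Kirchhoff's equations can be solved
  -- over ℚ and effective resistances are the same there as over the reals.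
  conductance : Fin n → Fin n → ℚ
  conductance k l = fromℕ (𝟙 (adj? k l))

  -- Total current leaving k along its edges (Ohm's law).
  outflow : (Fin n → ℚ) → Fin n → ℚ
  outflow v k = ∑[ l < n ] (conductance k l * (v k - v l))

  -- v is a potential when a unit current enters at i and leaves at j
  -- (Kirchhoff's current law).
  IsUnitPotential : Fin n → Fin n → (Fin n → ℚ) → Set
  IsUnitPotential i j v = ∀ k → outflow v k ≡ fromℕ (𝟙 (k ≟ᶠ i)) - fromℕ (𝟙 (k ≟ᶠ j))

private
  open +-*-Solver

  sum-zero : {f : Fin n → ℚ} → (∀ k → f k ≡ 0ℚ) → sum f ≡ 0ℚ
  sum-zero {n} f≡0 = trans (sum-cong-≗ f≡0) (sum-replicate-zero n)

  sum-neg : (f : Fin n → ℚ) → sum (λ k → - f k) ≡ - sum f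
  sum-neg {zero}  f = refl
  sum-neg {suc n} f = trans (cong (_+_ (- f zero)) (sum-neg (f ∘ suc)))
    (solve 2 (λ a b → :- a :+ :- b := :- (a :+ b)) refl (f zero) (sum (f ∘ suc)))

  sum-sub : (f g : Fin n → ℚ) → sum (λ k → f k - g k) ≡ sum f - sum g
  sum-sub f g = trans (∑-distrib-+ f (-_ ∘ g)) (cong (sum f +_) (sum-neg g))

  sum-δ : ∀ (i : Fin n) (x : Fin n → ℚ) → sum (λ l → fromℕ (𝟙 (l ≟ᶠ i)) * x l) ≡ x i
  sum-δ zero x = trans
    (cong₂ _+_ (*-identityˡ (x zero)) (sum-zero (λ l → *-zeroˡ (x (suc l)))))
    (+-identityʳ (x zero))
  sum-δ (suc i) x = trans
    (cong₂ _+_ (*-zeroˡ (x zero)) (trans (sum-cong-≗ step) (sum-δ i (x ∘ suc))))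
    (+-identityˡ (x (suc i)))
    where
    step : ∀ l → fromℕ (𝟙 (suc l ≟ᶠ suc i)) * x (suc l) ≡ fromℕ (𝟙 (l ≟ᶠ i)) * x (suc l)
    step l with l ≟ᶠ i
    ... | yes _ = refl
    ... | no _  = refl

  sum-δ-1 : ∀ (i : Fin n) → sum (λ l → fromℕ (𝟙 (l ≟ᶠ i))) ≡ 1ℚ
  sum-δ-1 i = trans (sum-cong-≗ (λ l → sym (*-identityʳ (fromℕ (𝟙 (l ≟ᶠ i))))))
                    (sum-δ i (λ _ → 1ℚ))

  sum-nonNeg : (f : Fin n → ℚ) → (∀ k → 0ℚ ≤ f k) → 0ℚ ≤ sum f
  sum-nonNeg {zero}  f f≥0 = ≤-refl
  sum-nonNeg {suc n} f f≥0 = +-mono-≤ (f≥0 zero) (sum-nonNeg (f ∘ suc) (f≥0 ∘ suc))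

  sum-nonNeg-zero : (f : Fin n → ℚ) → (∀ k → 0ℚ ≤ f k) → sum f ≡ 0ℚ → ∀ k → f k ≡ 0ℚ
  sum-nonNeg-zero {suc n} f f≥0 Σ≡0 = λ where
      zero    → f₀≡0
      (suc k) → sum-nonNeg-zero (f ∘ suc) (f≥0 ∘ suc) rest≡0 k
    where
    f₀ = f zero
    rest = sum (f ∘ suc)
    f₀≡0 : f₀ ≡ 0ℚ
    f₀≡0 = ≤-antisym
      (subst₂ _≤_ (+-identityʳ f₀) Σ≡0 (+-monoʳ-≤ f₀ (sum-nonNeg (f ∘ suc) (f≥0 ∘ suc))))
      (f≥0 zero)
    rest≡0 : rest ≡ 0ℚ
    rest≡0 = trans (sym (+-identityˡ rest)) (trans (cong (_+ rest) (sym f₀≡0)) Σ≡0)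

  p-q≡0⇒p≡q : ∀ p q → p - q ≡ 0ℚ → p ≡ q
  p-q≡0⇒p≡q p q p-q≡0 = trans
    (solve 2 (λ p q → p := p :- q :+ q) refl p q)
    (trans (cong (_+ q) p-q≡0) (+-identityˡ q))

  argmax : (v : Fin (suc n) → ℚ) → ∃ λ m → ∀ k → v k ≤ v m
  argmax {zero} v = zero , λ where zero → ≤-refl
  argmax {suc n} v with argmax (v ∘ suc)
  ... | m , max with ≤-total (v zero) (v (suc m))
  ...   | inj₁ v₀≤ = suc m , λ where
            zero    → v₀≤
            (suc k) → max k
  ...   | inj₂ ≤v₀ = zero , λ where
            zero    → ≤-refl
            (suc k) → ≤-trans (max k) ≤v₀

  Matrix : ℕ → Set
  Matrix n = Fin n → Fin n → ℚ

  apply : Matrix n → (Fin n → ℚ) → Fin n → ℚ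
  apply {n} A x k = ∑[ l < n ] (A k l * x l)

  Singular : Matrix n → Set
  Singular {n} A = ∃ λ (x : Fin n → ℚ) → (∃ λ k → x k ≢ 0ℚ) × (∀ k → apply A x k ≡ 0ℚ)

  Solvable : Matrix n → Set
  Solvable {n} A = ∀ (b : Fin n → ℚ) → ∃ λ x → ∀ k → apply A x k ≡ b k

  -- Gaussian elimination of the first unknown with pivot row p.
  module Eliminate (A : Matrix (suc n)) (p : Fin (suc n)) (A≢0 : A p zero ≢ 0ℚ) where
    instance
      pivot≢0 : ℚ.NonZero (A p zero)
      pivot≢0 = ℚ.≢-nonZero A≢0

    c⁻¹ : ℚ
    c⁻¹ = 1/ A p zero

    factor : Fin n → ℚ
    factor k = A (punchIn p k) zero * c⁻¹

    reduced : Matrix n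
    reduced k l = A (punchIn p k) (suc l) - factor k * A p (suc l)

    tailSum : (Fin n → ℚ) → Fin (suc n) → ℚ
    tailSum y k = ∑[ l < n ] (A k (suc l) * y l)

    extend : ℚ → (Fin n → ℚ) → Fin (suc n) → ℚ
    extend β y zero    = c⁻¹ * (β - tailSum y p)
    extend β y (suc l) = y l

    apply-reduced : ∀ y k →
      apply reduced y k ≡ tailSum y (punchIn p k) - factor k * tailSum y p
    apply-reduced y k = begin
      apply reduced y k
        ≡⟨ sum-cong-≗ (λ l → solve 4 (λ a m b y → (a :- m :* b) :* y := a :* y :- m :* (b :* y))
             refl (A (punchIn p k) (suc l)) (factor k) (A p (suc l)) (y l)) ⟩
      sum (λ l → A (punchIn p k) (suc l) * y l - factor k * (A p (suc l) * y l))
        ≡⟨ sum-sub (λ l → A (punchIn p k) (suc l) * y l) (λ l → factor k * (A p (suc l) * y l)) ⟩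
      tailSum y (punchIn p k) - sum (λ l → factor k * (A p (suc l) * y l))
        ≡⟨ cong (λ z → tailSum y (punchIn p k) - z)
             (*-distribˡ-sum (factor k) (λ l → A p (suc l) * y l)) ⟨
      tailSum y (punchIn p k) - factor k * tailSum y p ∎
      where open ≡-Reasoning

    extend-pivot : ∀ β y → apply A (extend β y) p ≡ β
    extend-pivot β y = begin
      A p zero * (c⁻¹ * (β - T)) + T  ≡⟨ cong (_+ T) (*-assoc (A p zero) c⁻¹ (β - T)) ⟨
      A p zero * c⁻¹ * (β - T) + T    ≡⟨ cong (λ z → z * (β - T) + T) (*-inverseʳ (A p zero)) ⟩
      1ℚ * (β - T) + T                ≡⟨ solve 2 (λ b t → con 1ℚ :* (b :- t) :+ t := b) refl β T ⟩
      β                               ∎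
      where
      open ≡-Reasoning
      T = tailSum y p

    extend-other : ∀ β y k γ → apply reduced y k ≡ γ - factor k * β →
                   apply A (extend β y) (punchIn p k) ≡ γ
    extend-other β y k γ eq = begin
      a * (c⁻¹ * (β - T)) + T′
        ≡⟨ solve 5 (λ a c b t t′ → a :* (c :* (b :- t)) :+ t′ := (t′ :- a :* c :* t) :+ a :* c :* b)
             refl a c⁻¹ β T T′ ⟩
      (T′ - factor k * T) + factor k * β
        ≡⟨ cong (_+ factor k * β) (trans (sym (apply-reduced y k)) eq) ⟩
      (γ - factor k * β) + factor k * β
        ≡⟨ solve 2 (λ g b → g :- b :+ b := g) refl γ (factor k * β) ⟩
      γ ∎
      where
      open ≡-Reasoning
      a  = A (punchIn p k) zero
      T  = tailSum y p
      T′ = tailSum y (punchIn p k)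

    backSubstitute : (b : Fin (suc n) → ℚ) (y : Fin n → ℚ) →
      (∀ k → apply reduced y k ≡ b (punchIn p k) - factor k * b p) →
      ∀ k → apply A (extend (b p) y) k ≡ b k
    backSubstitute b y eq k with p ≟ᶠ k
    ... | yes refl = extend-pivot (b p) y
    ... | no p≢k   = subst (λ k → apply A (extend (b p) y) k ≡ b k) (punchIn-punchOut p≢k)
      (extend-other (b p) y (punchOut p≢k) (b (punchIn p (punchOut p≢k))) (eq (punchOut p≢k)))

  singular⊎solvable : (A : Matrix n) → Singular A ⊎ Solvable A
  singular⊎solvable {zero}  A = inj₂ λ b → (λ ()) , λ ()
  singular⊎solvable {suc n} A with any? (λ p → ¬? (A p zero ≟ 0ℚ))
  ... | no all-zero = inj₁ (e₀ , (zero , λ ()) , λ k → begin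
      A k zero * 1ℚ + sum (λ l → A k (suc l) * 0ℚ)
        ≡⟨ cong₂ _+_ (trans (*-identityʳ (A k zero)) (col≡0 k))
                     (sum-zero (λ l → *-zeroʳ (A k (suc l)))) ⟩
      0ℚ ∎)
    where
    open ≡-Reasoning
    e₀ : Fin (suc n) → ℚ
    e₀ zero    = 1ℚ
    e₀ (suc _) = 0ℚ
    col≡0 : ∀ k → A k zero ≡ 0ℚ
    col≡0 k with A k zero ≟ 0ℚ
    ... | yes eq = eq
    ... | no neq = contradiction (k , neq) all-zero
  ... | yes (p , A≢0) with singular⊎solvable (Eliminate.reduced A p A≢0)
  ...   | inj₁ (y , (k , yk≢0) , By≡0) = inj₁ (extend 0ℚ y , (suc k , yk≢0) ,
            backSubstitute (λ _ → 0ℚ) y λ k → trans (By≡0 k)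
              (solve 1 (λ m → con 0ℚ := con 0ℚ :- m :* con 0ℚ) refl (factor k)))
    where open Eliminate A p A≢0
  ...   | inj₂ solveB = inj₂ λ b →
            let y , eq = solveB (λ k → b (punchIn p k) - factor k * b p)
            in extend (b p) y , backSubstitute b y eq
    where open Eliminate A p A≢0

module _ (G : SimpleGraph n) (conn : SimpleGraph.Connected G) where
  open SimpleGraph G

  private
    conductance-sym : ∀ k l → conductance k l ≡ conductance l k
    conductance-sym k l with adj? k l | adj? l k
    ... | yes _ | yes _ = refl
    ... | no _  | no _  = refl
    ... | yes a | no ¬a = contradiction (symm a) ¬a
    ... | no ¬a | yes a = contradiction (symm a) ¬a

    outflow-sub : ∀ v w k → outflow (λ l → v l - w l) k ≡ outflow v k - outflow w k
    outflow-sub v w k = trans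
      (sum-cong-≗ λ l → solve 5
        (λ a vk wk vl wl → a :* ((vk :- wk) :- (vl :- wl)) := a :* (vk :- vl) :- a :* (wk :- wl))
        refl (conductance k l) (v k) (w k) (v l) (w l))
      (sum-sub (λ l → conductance k l * (v k - v l)) (λ l → conductance k l * (w k - w l)))

    sum-outflow : ∀ v → sum (outflow v) ≡ 0ℚ
    sum-outflow v = begin
      sum (outflow v)
        ≡⟨ sum-cong-≗ (λ k → trans
             (sum-cong-≗ λ l → solve 3 (λ a x y → a :* (x :- y) := a :* x :- a :* y)
               refl (conductance k l) (v k) (v l))
             (sum-sub (λ l → conductance k l * v k) (λ l → conductance k l * v l))) ⟩
      sum (λ k → P k - Q k)
        ≡⟨ sum-sub P Q ⟩
      sum P - sum Q
        ≡⟨ cong (_- sum Q) (trans (∑-comm (λ k l → conductance k l * v k))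
             (sum-cong-≗ λ l → sum-cong-≗ λ k → cong (_* v k) (conductance-sym k l))) ⟩
      sum Q - sum Q
        ≡⟨ +-inverseʳ (sum Q) ⟩
      0ℚ ∎
      where
      open ≡-Reasoning
      P Q : Fin n → ℚ
      P k = ∑[ l < n ] (conductance k l * v k)
      Q k = ∑[ l < n ] (conductance k l * v l)

  -- The maximum principle.
  harmonic⇒constant : ∀ v → (∀ k → outflow v k ≡ 0ℚ) → ∀ i j → v i ≡ v j
  harmonic⇒constant v harmonic i j = helper (nonempty i) i j
    where
    nonempty : ∀ {m} → Fin m → ∃ λ m′ → m ≡ suc m′
    nonempty {suc m′} _ = m′ , refl

    maximum : (∃ λ m′ → n ≡ suc m′) → ∃ λ m → ∀ k → v k ≤ v m
    maximum (_ , refl) = argmax v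

    0≤p-q : ∀ {p q} → q ≤ p → 0ℚ ≤ p - q
    0≤p-q {p} {q} q≤p = subst (_≤ p - q) (+-inverseʳ q) (+-monoˡ-≤ (- q) q≤p)

    helper : (∃ λ m′ → n ≡ suc m′) → ∀ i j → v i ≡ v j
    helper ne i j = trans (reach (conn m i) refl) (sym (reach (conn m j) refl))
      where
      m   = proj₁ (maximum ne)
      max = proj₂ (maximum ne)

      step : ∀ {k l} → v k ≡ v m → Adj k l → v l ≡ v m
      step {k} {l} vk≡vm kl = trans (sym (p-q≡0⇒p≡q (v k) (v l) diff≡0)) vk≡vm
        where
        term≥0 : ∀ l → 0ℚ ≤ conductance k l * (v k - v l)
        term≥0 l with adj? k l
        ... | yes _ = subst (0ℚ ≤_) (sym (*-identityˡ (v k - v l)))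
                        (0≤p-q (subst (v l ≤_) (sym vk≡vm) (max l)))
        ... | no _  = ≤-reflexive (sym (*-zeroˡ (v k - v l)))
        term≡0 : conductance k l * (v k - v l) ≡ 0ℚ
        term≡0 = sum-nonNeg-zero _ term≥0 (harmonic k) l
        diff≡0 : v k - v l ≡ 0ℚ
        diff≡0 with adj? k l | term≡0
        ... | yes _ | eq = trans (sym (*-identityˡ (v k - v l))) eq
        ... | no ¬a | _  = contradiction kl ¬a

      reach : ∀ {k l} → Star Adj k l → v k ≡ v m → v l ≡ v m
      reach ε        eq = eq
      reach (a ◅ as) eq = reach as (step eq a)

  unitPotential-unique : ∀ {i j v w} → IsUnitPotential i j v → IsUnitPotential i j w →
                         v i - v j ≡ w i - w j
  unitPotential-unique {i} {j} {v} {w} vPot wPot = begin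
    v i - v j
      ≡⟨ solve 4 (λ a b c d → a :- b := (a :- c) :- (b :- d) :+ (c :- d))
           refl (v i) (v j) (w i) (w j) ⟩
    (v i - w i) - (v j - w j) + (w i - w j)
      ≡⟨ cong (λ z → z - (v j - w j) + (w i - w j)) const ⟩
    (v j - w j) - (v j - w j) + (w i - w j)
      ≡⟨ solve 2 (λ a b → a :- a :+ b := b) refl (v j - w j) (w i - w j) ⟩
    w i - w j ∎
    where
    open ≡-Reasoning
    const : v i - w i ≡ v j - w j
    const = harmonic⇒constant (λ l → v l - w l)
      (λ k → trans (outflow-sub v w k)
        (trans (cong (_- outflow w k) (trans (vPot k) (sym (wPot k)))) (+-inverseʳ (outflow w k)))) i j

  -- Solves the nonsingular system obtained from the Laplacian by joining
  -- the vertex o to ground with a unit conductance.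
  unitPotential : ∀ i j → ∃ (IsUnitPotential i j)
  unitPotential i j = conclude (singular⊎solvable grounded)
    where
    open ≡-Reasoning
    o = i
    δ : Fin n → Fin n → ℚ
    δ k l = fromℕ (𝟙 (l ≟ᶠ k))
    grounded : Matrix n
    grounded k l = (sum (conductance k) * δ k l - conductance k l) + δ o k * δ o l

    apply-grounded : ∀ v k → apply grounded v k ≡ outflow v k + δ o k * v o
    apply-grounded v k = begin
      apply grounded v k
        ≡⟨ sum-cong-≗ (λ l → solve 6
             (λ s d a e f x → ((s :* d :- a) :+ e :* f) :* x :=
                              (s :* (d :* x) :- a :* x) :+ e :* (f :* x))
             refl S (δ k l) (conductance k l) (δ o k) (δ o l) (v l)) ⟩
      sum (λ l → (S * (δ k l * v l) - conductance k l * v l) + δ o k * (δ o l * v l))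
        ≡⟨ ∑-distrib-+ (λ l → S * (δ k l * v l) - conductance k l * v l)
                       (λ l → δ o k * (δ o l * v l)) ⟩
      sum (λ l → S * (δ k l * v l) - conductance k l * v l) + sum (λ l → δ o k * (δ o l * v l))
        ≡⟨ cong₂ _+_ left
             (trans (sym (*-distribˡ-sum (δ o k) (λ l → δ o l * v l)))
                    (cong (δ o k *_) (sum-δ o v))) ⟩
      outflow v k + δ o k * v o ∎
      where
      S = sum (conductance k)
      left : sum (λ l → S * (δ k l * v l) - conductance k l * v l) ≡ outflow v k
      left = begin
        sum (λ l → S * (δ k l * v l) - conductance k l * v l)
          ≡⟨ sum-sub (λ l → S * (δ k l * v l)) (λ l → conductance k l * v l) ⟩
        sum (λ l → S * (δ k l * v l)) - sum (λ l → conductance k l * v l)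
          ≡⟨ cong (_- sum (λ l → conductance k l * v l)) (begin
               sum (λ l → S * (δ k l * v l))  ≡⟨ *-distribˡ-sum S (λ l → δ k l * v l) ⟨
               S * sum (λ l → δ k l * v l)    ≡⟨ cong (S *_) (sum-δ k v) ⟩
               S * v k                        ≡⟨ *-comm S (v k) ⟩
               v k * S                        ≡⟨ *-distribˡ-sum (v k) (conductance k) ⟩
               sum (λ l → v k * conductance k l) ∎) ⟩
        sum (λ l → v k * conductance k l) - sum (λ l → conductance k l * v l)
          ≡⟨ sum-sub (λ l → v k * conductance k l) (λ l → conductance k l * v l) ⟨
        sum (λ l → v k * conductance k l - conductance k l * v l)
          ≡⟨ sum-cong-≗ (λ l → solve 3 (λ a x y → x :* a :- a :* y := a :* (x :- y))
               refl (conductance k l) (v k) (v l)) ⟩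
        outflow v k ∎

    grounded-sum : ∀ v → sum (apply grounded v) ≡ v o
    grounded-sum v = begin
      sum (apply grounded v)
        ≡⟨ sum-cong-≗ (apply-grounded v) ⟩
      sum (λ k → outflow v k + δ o k * v o)
        ≡⟨ ∑-distrib-+ (outflow v) (λ k → δ o k * v o) ⟩
      sum (outflow v) + sum (λ k → δ o k * v o)
        ≡⟨ cong₂ _+_ (sum-outflow v) (sum-δ o (λ _ → v o)) ⟩
      0ℚ + v o
        ≡⟨ +-identityˡ (v o) ⟩
      v o ∎

    grounded-solution : ∀ v b → sum b ≡ 0ℚ → (∀ k → apply grounded v k ≡ b k) →
                        v o ≡ 0ℚ × (∀ k → outflow v k ≡ b k)
    grounded-solution v b Σb≡0 eq = vo≡0 , λ k → begin
      outflow v k                ≡⟨ +-identityʳ (outflow v k) ⟨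
      outflow v k + 0ℚ           ≡⟨ cong (outflow v k +_)
                                      (trans (cong (δ o k *_) vo≡0) (*-zeroʳ (δ o k))) ⟨
      outflow v k + δ o k * v o  ≡⟨ apply-grounded v k ⟨
      apply grounded v k         ≡⟨ eq k ⟩
      b k                        ∎
      where
      vo≡0 : v o ≡ 0ℚ
      vo≡0 = trans (sym (grounded-sum v)) (trans (sum-cong-≗ eq) Σb≡0)

    source : Fin n → ℚ
    source k = fromℕ (𝟙 (k ≟ᶠ i)) - fromℕ (𝟙 (k ≟ᶠ j))

    sum-source : sum source ≡ 0ℚ
    sum-source = trans (sum-sub (δ i) (δ j)) (cong₂ _-_ (sum-δ-1 i) (sum-δ-1 j))

    conclude : Singular grounded ⊎ Solvable grounded → ∃ (IsUnitPotential i j)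
    conclude (inj₁ (v , (k , vk≢0) , Av≡0)) =
      let vo≡0 , harmonic = grounded-solution v (λ _ → 0ℚ) (sum-zero {n} (λ _ → refl)) Av≡0
      in contradiction (trans (harmonic⇒constant v harmonic k o) vo≡0) vk≢0
    conclude (inj₂ solution) =
      let v , eq = solution source
      in v , proj₂ (grounded-solution v source sum-source eq)

  effectiveResistance : Fin n → Fin n → ℚ
  effectiveResistance i j = let v , _ = unitPotential i j in v i - v j

  effectiveResistance-unique : ∀ {i j v} → IsUnitPotential i j v →
                               effectiveResistance i j ≡ v i - v j
  effectiveResistance-unique {i} {j} {v} vPot =
    let u , uPot = unitPotential i j in unitPotential-unique {v = u} {w = v} uPot vPot

  additiveDegreeKirchhoff : ℚ
  additiveDegreeKirchhoff = ∑[ i < n ] ∑[ j < n ]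
    (fromℕ (𝟙 (i <? j)) * (fromℕ (degree i ℕ.+ degree j) * effectiveResistance i j))

{-# OPTIONS --safe #-}
-- By Dirichlet's principle, 2 (f i - f j) - E(f) is at most the resistance
-- between i and j for every f, where E is the Dirichlet energy. The test function
-- f = δ_i / d_i - δ_j / d_j gives R_ij ≥ 1/d_i + 1/d_j - 2 [i ~ j] / (d_i d_j).
-- Summing (d_i + d_j) R_ij over i < j, the terms in 1/d_i + 1/d_j contribute
-- N(N - 2) + 2|E| Σ 1/d_j, and the correction over the edges costs
-- 2 Σ_{i ~ j} (1/d_i + 1/d_j) = 2N.
module Submission where

open import Defs
open import Data.Nat.Base using (ℕ)
open import Data.Fin.Base using (Fin)
open import Data.Rational.Base using (_+_; _*_; _-_; _≥_)

open import Algebra.Bundles using (CommutativeRing)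
open import Data.Fin.Base using (zero; suc)
open import Data.Fin.Permutation using (_⟨$⟩ʳ_)
open import Data.Fin.Properties using (_<?_; <-cmp) renaming (_≟_ to _≟ᶠ_; <-irrefl to <ᶠ-irrefl)
import Data.Integer.Base as ℤ
import Data.Integer.Properties as ℤ
open import Data.Nat.Base as ℕ using (zero; suc)
import Data.Nat.Coprimality as Coprime
import Data.Nat.Properties as ℕ
open import Data.Product.Base using (_,_; uncurry)
open import Data.Rational.Base using (ℚ; mkℚ; 0ℚ; 1ℚ; -_; _/_; _≤_; nonNegative; nonPositive)
open import Data.Rational.Properties
  hiding (_<?_; <-cmp)
open import Data.Rational.Solver using (module +-*-Solver)
open import Data.Sum.Base using (inj₁; inj₂)
open import Function.Base using (_∘_)
open import Relation.Binary.Construct.Closure.ReflexiveTransitive using (ε; _◅_)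
open import Relation.Binary.Definitions using (tri<; tri≈; tri>)
open import Relation.Binary.PropositionalEquality
open import Relation.Nullary.Decidable using (yes; no; _×-dec_)
open import Relation.Nullary.Negation using (contradiction)
open import Algebra.Properties.Semiring.Sum
  (CommutativeRing.semiring +-*-commutativeRing)
  using (sum-cong-≗; sum-replicate-zero; ∑-distrib-+; ∑-comm; *-distribˡ-sum; ∑-permute)

open +-*-Solver using (solve; _:+_; _:*_; _:-_; :-_; con; _:=_)

private
  variable
    n : ℕ

-- Casts into ℚ and finite sums

-- `fromℕ` normalises by a gcd that is stuck on a variable `m`; exposing the constructor form lets
-- the rational operations compute.
fromℕ-mkℚ : ∀ m → fromℕ m ≡ mkℚ (ℤ.+ m) 0 (Coprime.sym (Coprime.1-coprimeTo m))
fromℕ-mkℚ m = normalize-coprime (Coprime.sym (Coprime.1-coprimeTo m))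

fromℕ-+ : ∀ a b → fromℕ (a ℕ.+ b) ≡ fromℕ a + fromℕ b
fromℕ-+ a b = trans
  -- Addition on ℚ cross-multiplies numerators and denominators, so factors `1` are inserted to
  -- match its unfolding.
  (cong fromℕ (sym (cong₂ ℕ._+_ (ℕ.*-identityʳ a) (ℕ.*-identityʳ b))))
  (trans (cong (_/ 1) (cong₂ ℤ._+_ (ℤ.pos-* a 1) (ℤ.pos-* b 1)))
         (sym (cong₂ _+_ (fromℕ-mkℚ a) (fromℕ-mkℚ b))))

fromℕ-*-reciprocal : ∀ m → fromℕ (suc m) * reciprocal (suc m) ≡ 1ℚ
fromℕ-*-reciprocal m = trans
  (cong₂ _*_ (fromℕ-mkℚ (suc m)) (normalize-coprime (Coprime.1-coprimeTo (suc m))))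
  -- `1/_` swaps numerator and denominator of a constructor form, which yields exactly the normal
  -- form of `reciprocal (suc m)`.
  (*-inverseʳ (mkℚ (ℤ.+ suc m) 0 (Coprime.sym (Coprime.1-coprimeTo (suc m)))))

fromℕ-sum : (f : Fin n → ℕ) → fromℕ (sumℕ f) ≡ sum (fromℕ ∘ f)
fromℕ-sum {zero}  f = refl
fromℕ-sum {suc n} f = trans (fromℕ-+ (f zero) (sumℕ (f ∘ suc)))
                            (cong (fromℕ (f zero) +_) (fromℕ-sum (f ∘ suc)))

≤-sumℕ : (f : Fin n → ℕ) → ∀ k → f k ℕ.≤ sumℕ f
≤-sumℕ f zero    = ℕ.m≤m+n (f zero) (sumℕ (f ∘ suc))
≤-sumℕ f (suc k) = ℕ.m≤n⇒m≤o+n (f zero) (≤-sumℕ (f ∘ suc) k)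

sum-1 : ∀ n → sum {n} (λ _ → 1ℚ) ≡ fromℕ n
sum-1 zero    = refl
sum-1 (suc n) = trans (cong (1ℚ +_) (sum-1 n)) (sym (fromℕ-+ 1 n))

sum-zero : {f : Fin n → ℚ} → (∀ k → f k ≡ 0ℚ) → sum f ≡ 0ℚ
sum-zero {n} f≡0 = trans (sum-cong-≗ f≡0) (sum-replicate-zero n)

sum-mono : {f g : Fin n → ℚ} → (∀ k → f k ≤ g k) → sum f ≤ sum g
sum-mono {zero}  f≤g = ≤-refl
sum-mono {suc n} f≤g = +-mono-≤ (f≤g zero) (sum-mono (f≤g ∘ suc))

sum-linear : ∀ a b (f g : Fin n → ℚ) →
             sum (λ k → a * f k + b * g k) ≡ a * sum f + b * sum g
sum-linear a b f g = trans (∑-distrib-+ (λ k → a * f k) (λ k → b * g k))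
  (sym (cong₂ _+_ (*-distribˡ-sum a f) (*-distribˡ-sum b g)))

sum-sub : (f g : Fin n → ℚ) → sum (λ k → f k - g k) ≡ sum f - sum g
sum-sub f g = trans
  (sum-cong-≗ λ k → solve 2 (λ a b → a :- b := con 1ℚ :* a :+ con (- 1ℚ) :* b) refl (f k) (g k))
  (trans (sum-linear 1ℚ (- 1ℚ) f g)
    (solve 2 (λ a b → con 1ℚ :* a :+ con (- 1ℚ) :* b := a :- b) refl (sum f) (sum g)))

-- Indicators and sums over pairs of indices

δ : Fin n → Fin n → ℚ
δ k i = fromℕ (𝟙 (k ≟ᶠ i))

sum-δ : ∀ (i : Fin n) (x : Fin n → ℚ) → sum (λ l → δ l i * x l) ≡ x i
sum-δ zero x = trans
  (cong₂ _+_ (*-identityˡ (x zero)) (sum-zero (λ l → *-zeroˡ (x (suc l)))))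
  (+-identityʳ (x zero))
sum-δ (suc i) x = trans
  (cong₂ _+_ (*-zeroˡ (x zero)) (trans (sum-cong-≗ step) (sum-δ i (x ∘ suc))))
  (+-identityˡ (x (suc i)))
  where
  step : ∀ l → δ (suc l) (suc i) * x (suc l) ≡ δ l i * x (suc l)
  step l with l ≟ᶠ i
  ... | yes _ = refl
  ... | no _  = refl

δ-refl : (i : Fin n) → δ i i ≡ 1ℚ
δ-refl i with i ≟ᶠ i
... | yes _  = refl
... | no i≢i = contradiction refl i≢i

δ-≢ : {i j : Fin n} → i ≢ j → δ i j ≡ 0ℚ
δ-≢ {i = i} {j} i≢j with i ≟ᶠ j
... | yes i≡j = contradiction i≡j i≢j
... | no _    = refl

χ : Fin n → Fin n → ℚ
χ i j = fromℕ (𝟙 (i <? j))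

-- A partition of unity that cuts a square array into its two triangles and its diagonal. The
-- comparison `<-cmp` refutes the inconsistent outcomes of the three tests.
χ-trichotomy : (i j : Fin n) → χ i j + χ j i + δ j i ≡ 1ℚ
χ-trichotomy i j with i <? j | j <? i | j ≟ᶠ i | <-cmp i j
... | yes _   | no _    | no _    | _            = refl
... | no _    | yes _   | no _    | _            = refl
... | no _    | no _    | yes _   | _            = refl
... | yes i<j | yes _   | _       | tri> i≮j _ _ = contradiction i<j i≮j
... | yes _   | yes j<i | _       | tri< _ _ j≮i = contradiction j<i j≮i
... | yes i<j | yes _   | _       | tri≈ i≮j _ _ = contradiction i<j i≮j
... | yes i<j | _       | yes eq  | _            = contradiction i<j (<ᶠ-irrefl (sym eq))
... | no _    | yes j<i | yes eq  | _            = contradiction j<i (<ᶠ-irrefl eq)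
... | no i≮j  | no _    | no _    | tri< i<j _ _ = contradiction i<j i≮j
... | no _    | no _    | no j≢i  | tri≈ _ eq _  = contradiction (sym eq) j≢i
... | no _    | no j≮i  | no _    | tri> _ _ j<i = contradiction j<i j≮i

-- The lower triangle is folded onto the upper one by exchanging the order of summation. This serves
-- both the edge count and the Kirchhoff index.
sum-upperTriangle : (h : Fin n → Fin n → ℚ) →
  ∑[ i < n ] ∑[ j < n ] (χ i j * (h i j + h j i)) + ∑[ i < n ] h i i ≡
  ∑[ i < n ] ∑[ j < n ] h i j
sum-upperTriangle {n} h = sym (begin
  ∑[ i < n ] ∑[ j < n ] h i j
    ≡⟨ sum-cong-≗ (λ i → trans
         (sum-cong-≗ λ j → trans (sym (*-identityˡ (h i j)))
           (trans (cong (_* h i j) (sym (χ-trichotomy i j)))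
             (solve 4 (λ a b c x → (a :+ b :+ c) :* x := a :* x :+ b :* x :+ c :* x)
               refl (χ i j) (χ j i) (δ j i) (h i j))))
         (trans (∑-distrib-+ (λ j → χ i j * h i j + χ j i * h i j) (λ j → δ j i * h i j))
                (cong₂ _+_ (∑-distrib-+ (λ j → χ i j * h i j) (λ j → χ j i * h i j))
                           (sum-δ i (h i))))) ⟩
  ∑[ i < n ] (U i + L i + h i i)
    ≡⟨ trans (∑-distrib-+ (λ i → U i + L i) (λ i → h i i))
             (cong (_+ ∑[ i < n ] h i i) (∑-distrib-+ U L)) ⟩
  sum U + sum L + ∑[ i < n ] h i i
    ≡⟨ cong (λ z → sum U + z + ∑[ i < n ] h i i) (∑-comm (λ i j → χ j i * h i j)) ⟩
  sum U + sum L′ + ∑[ i < n ] h i i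
    ≡⟨ cong (_+ ∑[ i < n ] h i i) (trans (sym (∑-distrib-+ U L′))
         (sum-cong-≗ λ i → trans
           (sym (∑-distrib-+ (λ j → χ i j * h i j) (λ j → χ i j * h j i)))
           (sum-cong-≗ λ j → sym (*-distribˡ-+ (χ i j) (h i j) (h j i))))) ⟩
  ∑[ i < n ] ∑[ j < n ] (χ i j * (h i j + h j i)) + ∑[ i < n ] h i i ∎)
  where
  open ≡-Reasoning
  U L L′ : Fin n → ℚ
  U i  = ∑[ j < n ] (χ i j * h i j)
  L i  = ∑[ j < n ] (χ j i * h i j)
  L′ i = ∑[ j < n ] (χ i j * h j i)

-- Order facts

0≤p² : ∀ p → 0ℚ ≤ p * p
0≤p² p with ≤-total 0ℚ p
... | inj₁ 0≤p = subst (_≤ p * p) (*-zeroˡ p) (*-monoʳ-≤-nonNeg p {{nonNegative 0≤p}} 0≤p)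
... | inj₂ p≤0 = subst (_≤ p * p) (*-zeroˡ p) (*-monoʳ-≤-nonPos p {{nonPositive p≤0}} p≤0)

0≤p+p⇒0≤p : ∀ {p} → 0ℚ ≤ p + p → 0ℚ ≤ p
0≤p+p⇒0≤p {p} 0≤p+p = ≮⇒≥ λ p<0 →
  <-irrefl refl (≤-<-trans 0≤p+p (+-mono-< {p} {0ℚ} {p} {0ℚ} p<0 p<0))

0≤q-p⇒p≤q : ∀ {p q} → 0ℚ ≤ q - p → p ≤ q
0≤q-p⇒p≤q {p} {q} 0≤q-p = subst₂ _≤_ (+-identityˡ p)
  (solve 2 (λ p q → q :- p :+ p := q) refl p q) (+-monoˡ-≤ p 0≤q-p)

-- Conductances and the handshake lemma

module _ (G : SimpleGraph n) where
  open SimpleGraph G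

  conductance-sym : ∀ k l → conductance k l ≡ conductance l k
  conductance-sym k l with adj? k l | adj? l k
  ... | yes _ | yes _ = refl
  ... | no _  | no _  = refl
  ... | yes a | no ¬a = contradiction (symm a) ¬a
  ... | no ¬a | yes a = contradiction (symm a) ¬a

  conductance-irrefl : ∀ k → conductance k k ≡ 0ℚ
  conductance-irrefl k with adj? k k
  ... | yes a = contradiction a irrefl
  ... | no _  = refl

  0≤conductance : ∀ k l → 0ℚ ≤ conductance k l
  0≤conductance k l with adj? k l
  ... | yes _ = nonNegative⁻¹ 1ℚ
  ... | no _  = ≤-refl

  degree-conductance : ∀ k → fromℕ (degree k) ≡ sum (conductance k)
  degree-conductance k = fromℕ-sum (λ l → 𝟙 (adj? k l))

  -- The symmetric conductance matrix has zero diagonal, so twice its upper triangle is the whole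
  -- matrix, whose row sums are the degrees.
  handshake : fromℕ 2 * fromℕ ∣E∣ ≡ ∑[ k < n ] fromℕ (degree k)
  handshake = begin
    fromℕ 2 * fromℕ ∣E∣
      ≡⟨ cong (fromℕ 2 *_) (trans (fromℕ-sum (λ i → sumℕ (edges i)))
           (sum-cong-≗ λ i → trans (fromℕ-sum (edges i)) (sum-cong-≗ λ j → edge i j))) ⟩
    fromℕ 2 * ∑[ i < n ] ∑[ j < n ] (χ i j * conductance i j)
      ≡⟨ trans (*-distribˡ-sum (fromℕ 2) (λ i → ∑[ j < n ] (χ i j * conductance i j)))
           (sum-cong-≗ λ i → trans
             (*-distribˡ-sum (fromℕ 2) (λ j → χ i j * conductance i j))
             (sum-cong-≗ λ j → trans
               (solve 2 (λ x c → con (fromℕ 2) :* (x :* c) := x :* (c :+ c)) refl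
                 (χ i j) (conductance i j))
               (cong (λ z → χ i j * (conductance i j + z)) (conductance-sym i j)))) ⟩
    upper
      ≡⟨ +-identityʳ upper ⟨
    upper + 0ℚ
      ≡⟨ cong (upper +_) (sum-zero conductance-irrefl) ⟨
    upper + ∑[ i < n ] conductance i i
      ≡⟨ sum-upperTriangle conductance ⟩
    ∑[ i < n ] ∑[ j < n ] conductance i j
      ≡⟨ sum-cong-≗ degree-conductance ⟨
    ∑[ k < n ] fromℕ (degree k) ∎
    where
    open ≡-Reasoning
    upper = ∑[ i < n ] ∑[ j < n ] (χ i j * (conductance i j + conductance j i))
    edges : Fin n → Fin n → ℕ
    edges i j = 𝟙 (i <? j ×-dec adj? i j)
    edge : ∀ i j → fromℕ (edges i j) ≡ χ i j * conductance i j
    edge i j with i <? j | adj? i j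
    ... | yes _ | yes _ = refl
    ... | yes _ | no _  = refl
    ... | no _  | yes _ = refl
    ... | no _  | no _  = refl

  -- Dirichlet energy and Dirichlet's principle

  -- The bilinear form of the graph Laplacian; on the diagonal `u = v` it is the Dirichlet energy.
  -- In this shape Kirchhoff's law can be substituted directly for `outflow v`.
  energy : (Fin n → ℚ) → (Fin n → ℚ) → ℚ
  energy u v = ∑[ k < n ] (u k * outflow v k)

  -- Green's identity, doubled because the right-hand side counts every edge twice.
  green : ∀ u v → energy u v + energy u v ≡
          ∑[ k < n ] ∑[ l < n ] (conductance k l * ((u k - u l) * (v k - v l)))
  green u v = begin
    energy u v + energy u v
      -- The second copy is summed in the other order, so that the terms of `(k , l)` and `(l , k)`
      -- meet and combine into a product of differences.
      ≡⟨ cong₂ _+_ expand (trans expand (∑-comm (λ k l → u k * (conductance k l * (v k - v l))))) ⟩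
    sum (λ k → sum λ l → u k * (conductance k l * (v k - v l))) +
    sum (λ l → sum λ k → u k * (conductance k l * (v k - v l)))
      ≡⟨ ∑-distrib-+ (λ k → sum λ l → u k * (conductance k l * (v k - v l)))
                     (λ l → sum λ k → u k * (conductance k l * (v k - v l))) ⟨
    sum (λ k → sum (λ l → u k * (conductance k l * (v k - v l))) +
               sum (λ l → u l * (conductance l k * (v l - v k))))
      ≡⟨ sum-cong-≗ (λ k → trans
           (sym (∑-distrib-+ (λ l → u k * (conductance k l * (v k - v l)))
                             (λ l → u l * (conductance l k * (v l - v k)))))
           (sum-cong-≗ λ l → trans
             (cong (λ c → u k * (conductance k l * (v k - v l)) + u l * (c * (v l - v k)))
                   (conductance-sym l k))
             (solve 5 (λ c a b x y → a :* (c :* (x :- y)) :+ b :* (c :* (y :- x)) :=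
                                     c :* ((a :- b) :* (x :- y)))
               refl (conductance k l) (u k) (u l) (v k) (v l)))) ⟩
    ∑[ k < n ] ∑[ l < n ] (conductance k l * ((u k - u l) * (v k - v l))) ∎
    where
    open ≡-Reasoning
    expand : energy u v ≡ sum (λ k → sum λ l → u k * (conductance k l * (v k - v l)))
    expand = sum-cong-≗ λ k → *-distribˡ-sum (u k) (λ l → conductance k l * (v k - v l))

  -- The Laplacian of `v` is a unit source at `i` and a unit sink at `j`, so pairing it with `u`
  -- samples `u` at these two vertices.
  energy-unitPotential : ∀ u {i j} v → IsUnitPotential i j v → energy u v ≡ u i - u j
  energy-unitPotential u {i} {j} v vPot = begin
    energy u v
      ≡⟨ sum-cong-≗ (λ k → trans (cong (u k *_) (vPot k))
           (solve 3 (λ u x y → u :* (x :- y) := x :* u :- y :* u) refl (u k) (δ k i) (δ k j))) ⟩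
    sum (λ k → δ k i * u k - δ k j * u k)
      ≡⟨ sum-sub (λ k → δ k i * u k) (λ k → δ k j * u k) ⟩
    sum (λ k → δ k i * u k) - sum (λ k → δ k j * u k)
      ≡⟨ cong₂ _-_ (sum-δ i u) (sum-δ j u) ⟩
    u i - u j ∎
    where open ≡-Reasoning

  -- Expand the nonnegative energy of v - f.
  dirichlet : ∀ f {i j} v → IsUnitPotential i j v →
              fromℕ 2 * (f i - f j) - energy f f ≤ v i - v j
  dirichlet f {i} {j} v vPot = 0≤q-p⇒p≤q (0≤p+p⇒0≤p (begin
    0ℚ
      ≡⟨ sum-zero {n} (λ _ → sum-replicate-zero n) ⟨
    ∑[ k < n ] ∑[ l < n ] 0ℚ
      ≤⟨ sum-mono (λ k → sum-mono λ l → term≥0 k l) ⟩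
    ∑[ k < n ] ∑[ l < n ] (conductance k l * ((w k - w l) * (w k - w l)))
      -- The square is expanded bilinearly; the factors `1ℚ` give the shape that `sum-linear`
      -- accepts.
      ≡⟨ sum-cong-≗ (λ k → trans
           (sum-cong-≗ λ l → solve 5
             (λ c a b x y → c :* (((a :- x) :- (b :- y)) :* ((a :- x) :- (b :- y))) :=
               con 1ℚ :* (con 1ℚ :* (c :* ((a :- b) :* (a :- b)))
                          :+ con (- fromℕ 2) :* (c :* ((x :- y) :* (a :- b))))
               :+ con 1ℚ :* (c :* ((x :- y) :* (x :- y))))
             refl (conductance k l) (v k) (v l) (f k) (f l))
           (trans (sum-linear 1ℚ 1ℚ (λ l → 1ℚ * D v v k l + - fromℕ 2 * D f v k l) (D f f k))
             (cong (λ z → 1ℚ * z + 1ℚ * sum (D f f k))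
               (sum-linear 1ℚ (- fromℕ 2) (D v v k) (D f v k))))) ⟩
    sum (λ k → 1ℚ * (1ℚ * sum (D v v k) + - fromℕ 2 * sum (D f v k)) + 1ℚ * sum (D f f k))
      ≡⟨ trans (sum-linear 1ℚ 1ℚ (λ k → 1ℚ * sum (D v v k) + - fromℕ 2 * sum (D f v k))
                                 (sum ∘ D f f))
           (cong (λ z → 1ℚ * z + 1ℚ * sum (sum ∘ D f f))
             (sum-linear 1ℚ (- fromℕ 2) (sum ∘ D v v) (sum ∘ D f v))) ⟩
    1ℚ * (1ℚ * sum (sum ∘ D v v) + - fromℕ 2 * sum (sum ∘ D f v)) + 1ℚ * sum (sum ∘ D f f)
      -- By Green's identity each double sum is twice an energy, and those involving `v` are
      -- potential drops. The desired difference thus appears twice, which `0≤p+p⇒0≤p` undoes.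
      ≡⟨ cong₂ (λ y z → 1ℚ * y + 1ℚ * z)
           (cong₂ (λ y z → 1ℚ * y + - fromℕ 2 * z) (via v) (via f)) (sym (green f f)) ⟩
    1ℚ * (1ℚ * (R + R) + - fromℕ 2 * (Δ + Δ)) + 1ℚ * (E + E)
      ≡⟨ solve 3 (λ r d e →
           con 1ℚ :* (con 1ℚ :* (r :+ r) :+ con (- fromℕ 2) :* (d :+ d)) :+ con 1ℚ :* (e :+ e) :=
           (r :- (con (fromℕ 2) :* d :- e)) :+ (r :- (con (fromℕ 2) :* d :- e)))
           refl R Δ E ⟩
    (R - (fromℕ 2 * Δ - E)) + (R - (fromℕ 2 * Δ - E)) ∎))
    where
    open ≤-Reasoning
    w : Fin n → ℚ
    w k = v k - f k
    R = v i - v j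
    Δ = f i - f j
    E = energy f f
    D : (Fin n → ℚ) → (Fin n → ℚ) → Fin n → Fin n → ℚ
    D x y k l = conductance k l * ((x k - x l) * (y k - y l))
    via : ∀ x → sum (sum ∘ D x v) ≡ (x i - x j) + (x i - x j)
    via x = trans (sym (green x v))
      (cong₂ _+_ (energy-unitPotential x v vPot) (energy-unitPotential x v vPot))
    term≥0 : ∀ k l → 0ℚ ≤ conductance k l * ((w k - w l) * (w k - w l))
    term≥0 k l = subst (_≤ conductance k l * ((w k - w l) * (w k - w l)))
      (*-zeroʳ (conductance k l))
      (*-monoˡ-≤-nonNeg (conductance k l) {{nonNegative (0≤conductance k l)}} (0≤p² (w k - w l)))

  -- The dipole test function

  deg ρ : Fin n → ℚ
  deg k = fromℕ (degree k)
  ρ k   = reciprocal (degree k)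

  -- The weights stay free here, so that the energy is a polynomial identity in them. They become
  -- the reciprocal degrees later, which maximise the Dirichlet bound when `i` and `j` are not
  -- adjacent.
  module Dipole (i j : Fin n) (i≢j : i ≢ j) (p q : ℚ) where
    dipole : Fin n → ℚ
    dipole k = p * δ k i - q * δ k j

    dipole-i : dipole i ≡ p
    dipole-i = trans (cong₂ (λ y z → p * y - q * z) (δ-refl i) (δ-≢ i≢j))
      (solve 2 (λ p q → p :* con 1ℚ :- q :* con 0ℚ := p) refl p q)

    dipole-j : dipole j ≡ - q
    dipole-j = trans (cong₂ (λ y z → p * y - q * z) (δ-≢ (i≢j ∘ sym)) (δ-refl j))
      (solve 2 (λ p q → p :* con 0ℚ :- q :* con 1ℚ := :- q) refl p q)

    sum-dipole : ∀ x → ∑[ k < n ] (dipole k * x k) ≡ p * x i - q * x j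
    sum-dipole x = begin
      ∑[ k < n ] (dipole k * x k)
        ≡⟨ sum-cong-≗ (λ k → solve 5
             (λ p q a b x → (p :* a :- q :* b) :* x := p :* (a :* x) :+ :- q :* (b :* x))
             refl p q (δ k i) (δ k j) (x k)) ⟩
      sum (λ k → p * (δ k i * x k) + - q * (δ k j * x k))
        ≡⟨ sum-linear p (- q) (λ k → δ k i * x k) (λ k → δ k j * x k) ⟩
      p * sum (λ k → δ k i * x k) + - q * sum (λ k → δ k j * x k)
        ≡⟨ cong₂ (λ y z → p * y + - q * z) (sum-δ i x) (sum-δ j x) ⟩
      p * x i + - q * x j
        ≡⟨ solve 4 (λ p q a b → p :* a :+ :- q :* b := p :* a :- q :* b) refl p q (x i) (x j) ⟩
      p * x i - q * x j ∎
      where open ≡-Reasoning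

    -- This is the Laplacian written as the degree matrix minus the adjacency matrix.
    outflow-dipole : ∀ k → outflow dipole k ≡
                     deg k * dipole k - (p * conductance k i - q * conductance k j)
    outflow-dipole k = begin
      outflow dipole k
        ≡⟨ sum-cong-≗ (λ l → solve 3 (λ c x y → c :* (x :- y) := x :* c :- y :* c) refl
             (conductance k l) (dipole k) (dipole l)) ⟩
      sum (λ l → dipole k * conductance k l - dipole l * conductance k l)
        ≡⟨ sum-sub (λ l → dipole k * conductance k l) (λ l → dipole l * conductance k l) ⟩
      sum (λ l → dipole k * conductance k l) - sum (λ l → dipole l * conductance k l)
        ≡⟨ cong₂ _-_ (trans (sym (*-distribˡ-sum (dipole k) (conductance k)))
                       (trans (*-comm (dipole k) (sum (conductance k)))
                              (cong (_* dipole k) (sym (degree-conductance k)))))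
                     (sum-dipole (conductance k)) ⟩
      deg k * dipole k - (p * conductance k i - q * conductance k j) ∎
      where open ≡-Reasoning

    -- Only the outflows at `i` and `j` count. The cross term is positive because the dipole takes
    -- the values `p` and `- q`, of opposite sign for positive weights, across an edge joining them.
    energy-dipole : energy dipole dipole ≡
      deg i * p * p + deg j * q * q + fromℕ 2 * (conductance i j * (p * q))
    energy-dipole = begin
      energy dipole dipole
        ≡⟨ sum-dipole (outflow dipole) ⟩
      p * outflow dipole i - q * outflow dipole j
        ≡⟨ cong₂ (λ y z → p * y - q * z)
             (trans (outflow-dipole i) (cong₂ (λ y z → deg i * y - (p * z - q * conductance i j))
               dipole-i (conductance-irrefl i)))
             (trans (outflow-dipole j) (trans
               (cong₂ (λ y z → deg j * y - (p * conductance j i - q * z))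
                 dipole-j (conductance-irrefl j))
               (cong (λ z → deg j * - q - (p * z - q * 0ℚ)) (conductance-sym j i)))) ⟩
      p * (deg i * p - (p * 0ℚ - q * conductance i j)) -
      q * (deg j * - q - (p * conductance i j - q * 0ℚ))
        ≡⟨ solve 5 (λ a b p q c →
             p :* (a :* p :- (p :* con 0ℚ :- q :* c)) :-
             q :* (b :* :- q :- (p :* c :- q :* con 0ℚ)) :=
             a :* p :* p :+ b :* q :* q :+ con (fromℕ 2) :* (c :* (p :* q)))
             refl (deg i) (deg j) p q (conductance i j) ⟩
      deg i * p * p + deg j * q * q + fromℕ 2 * (conductance i j * (p * q)) ∎
      where open ≡-Reasoning

  -- The edge to `k` contributes 1 to the degree sum, so the degree is a successor and the default
  -- `reciprocal zero` does not arise.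
  adjacent⇒deg-*-ρ : ∀ {i k} → Adj i k → deg i * ρ i ≡ 1ℚ
  adjacent⇒deg-*-ρ {i} {k} a with degree i | ≤-sumℕ (λ l → 𝟙 (adj? i l)) k
  ... | suc m | _  = fromℕ-*-reciprocal m
  ... | zero  | le with adj? i k
  ...   | yes _ = contradiction le λ ()
  ...   | no ¬a = contradiction a ¬a

-- Lower bounds for resistances

module _ (G : SimpleGraph n) (conn : SimpleGraph.Connected G) where
  open SimpleGraph G

  -- A walk from `i` to a different vertex has a first edge, which gives `i` a neighbour.
  deg-*-ρ : ∀ {i j} → i ≢ j → deg G i * ρ G i ≡ 1ℚ
  deg-*-ρ {i} {j} i≢j with conn i j
  ... | ε     = contradiction refl i≢j
  ... | a ◅ _ = adjacent⇒deg-*-ρ G a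

  resistance≥ : ∀ i j → i ≢ j →
    ρ G i + ρ G j - fromℕ 2 * (conductance i j * (ρ G i * ρ G j)) ≤ effectiveResistance G conn i j
  resistance≥ i j i≢j = begin
    x + y - fromℕ 2 * (c * (x * y))
      ≡⟨ solve 3 (λ x y c → x :+ y :- con (fromℕ 2) :* (c :* (x :* y)) :=
           con (fromℕ 2) :* (x :- :- y) :-
           (con 1ℚ :* x :+ con 1ℚ :* y :+ con (fromℕ 2) :* (c :* (x :* y)))) refl x y c ⟩
    fromℕ 2 * (x - - y) - (1ℚ * x + 1ℚ * y + fromℕ 2 * (c * (x * y)))
      -- Each `1ℚ` becomes degree times reciprocal, turning the linear terms into the quadratic
      -- terms of the dipole energy.
      ≡⟨ cong₂ (λ a b → fromℕ 2 * (x - - y) - (a * x + b * y + fromℕ 2 * (c * (x * y))))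
           (deg-*-ρ i≢j) (deg-*-ρ (i≢j ∘ sym)) ⟨
    fromℕ 2 * (x - - y) - (deg G i * x * x + deg G j * y * y + fromℕ 2 * (c * (x * y)))
      ≡⟨ cong₂ _-_ (cong (fromℕ 2 *_) (cong₂ _-_ dipole-i dipole-j)) energy-dipole ⟨
    fromℕ 2 * (dipole i - dipole j) - energy G dipole dipole
      ≤⟨ uncurry (dirichlet G dipole) (unitPotential G conn i j) ⟩
    effectiveResistance G conn i j ∎
    where
    open ≤-Reasoning
    x = ρ G i
    y = ρ G j
    c = conductance i j
    open Dipole G i j i≢j x y

  -- Where deg i * ρ i ≡ 1, h i j + h j i is (deg i + deg j) times the bound of resistance≥.
  h : Fin n → Fin n → ℚ
  h i j = 1ℚ + deg G i * ρ G j - fromℕ 2 * (conductance i j * ρ G i)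

  -- Splitting the bound for a pair as `h i j + h j i` is what lets `sum-upperTriangle` replace the
  -- sum over `i < j` by a full double sum.
  h-sym≤ : ∀ i j → i ≢ j →
    h i j + h j i ≤ fromℕ (degree i ℕ.+ degree j) * effectiveResistance G conn i j
  h-sym≤ i j i≢j = begin
    (1ℚ + a * y - fromℕ 2 * (c * x)) + (1ℚ + b * x - fromℕ 2 * (conductance j i * y))
      ≡⟨ cong (λ z → (1ℚ + a * y - fromℕ 2 * (c * x)) + (1ℚ + b * x - fromℕ 2 * (z * y)))
           (conductance-sym G j i) ⟩
    (1ℚ + a * y - fromℕ 2 * (c * x)) + (1ℚ + b * x - fromℕ 2 * (c * y))
      ≡⟨ solve 5 (λ a b x y c →
           (con 1ℚ :+ a :* y :- con (fromℕ 2) :* (c :* x)) :+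
           (con 1ℚ :+ b :* x :- con (fromℕ 2) :* (c :* y)) :=
           con 1ℚ :+ a :* y :+ b :* x :+ con 1ℚ :-
           con (fromℕ 2) :* (c :* (con 1ℚ :* y :+ con 1ℚ :* x))) refl a b x y c ⟩
    1ℚ + a * y + b * x + 1ℚ - fromℕ 2 * (c * (1ℚ * y + 1ℚ * x))
      -- Expanding every `1ℚ` as degree times reciprocal makes the expression divisible by `a + b`.
      ≡⟨ cong₂ (λ u v → u + a * y + b * x + v - fromℕ 2 * (c * (u * y + v * x)))
           (deg-*-ρ i≢j) (deg-*-ρ (i≢j ∘ sym)) ⟨
    a * x + a * y + b * x + b * y - fromℕ 2 * (c * (a * x * y + b * y * x))
      ≡⟨ solve 5 (λ a b x y c →
           a :* x :+ a :* y :+ b :* x :+ b :* y :-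
           con (fromℕ 2) :* (c :* (a :* x :* y :+ b :* y :* x)) :=
           (a :+ b) :* (x :+ y :- con (fromℕ 2) :* (c :* (x :* y)))) refl a b x y c ⟩
    (a + b) * (x + y - fromℕ 2 * (c * (x * y)))
      ≡⟨ cong (_* (x + y - fromℕ 2 * (c * (x * y)))) (fromℕ-+ (degree i) (degree j)) ⟨
    fromℕ (degree i ℕ.+ degree j) * (x + y - fromℕ 2 * (c * (x * y)))
      ≤⟨ *-monoˡ-≤-nonNeg (fromℕ (degree i ℕ.+ degree j))
           {{normalize-nonNeg (degree i ℕ.+ degree j) 1}} (resistance≥ i j i≢j) ⟩
    fromℕ (degree i ℕ.+ degree j) * effectiveResistance G conn i j ∎
    where
    open ≤-Reasoning
    a = deg G i
    b = deg G j
    x = ρ G i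
    y = ρ G j
    c = conductance i j

  -- Summation over all pairs

  module _ (deg-*-ρ≡1 : ∀ i → deg G i * ρ G i ≡ 1ℚ) where
    -- The conductances of a row add up to `deg G i`, which cancels against `ρ G i`, so the
    -- adjacency correction costs exactly 2 per row.
    sum-h-row : ∀ i → sum (h i) ≡ (fromℕ n - fromℕ 2) * 1ℚ + sum (ρ G) * deg G i
    sum-h-row i = begin
      sum (h i)
        ≡⟨ sum-cong-≗ (λ j → solve 4 (λ a x y c →
             con 1ℚ :+ a :* y :- con (fromℕ 2) :* (c :* x) :=
             con 1ℚ :* (con 1ℚ :* con 1ℚ :+ a :* y) :+ (:- (con (fromℕ 2) :* x)) :* c)
             refl (deg G i) (ρ G i) (ρ G j) (conductance i j)) ⟩
      sum (λ j → 1ℚ * (1ℚ * 1ℚ + deg G i * ρ G j) + - (fromℕ 2 * ρ G i) * conductance i j)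
        ≡⟨ sum-linear 1ℚ (- (fromℕ 2 * ρ G i)) (λ j → 1ℚ * 1ℚ + deg G i * ρ G j)
             (conductance i) ⟩
      1ℚ * sum (λ j → 1ℚ * 1ℚ + deg G i * ρ G j) + - (fromℕ 2 * ρ G i) * sum (conductance i)
        ≡⟨ cong₂ (λ y z → 1ℚ * y + - (fromℕ 2 * ρ G i) * z)
             (trans (sum-linear 1ℚ (deg G i) (λ _ → 1ℚ) (ρ G))
                    (cong (λ z → 1ℚ * z + deg G i * sum (ρ G)) (sum-1 n)))
             (sym (degree-conductance G i)) ⟩
      1ℚ * (1ℚ * fromℕ n + deg G i * sum (ρ G)) + - (fromℕ 2 * ρ G i) * deg G i
        ≡⟨ solve 4 (λ m a p x →
             con 1ℚ :* (con 1ℚ :* m :+ a :* p) :+ (:- (con (fromℕ 2) :* x)) :* a :=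
             m :+ p :* a :- con (fromℕ 2) :* (a :* x))
             refl (fromℕ n) (deg G i) (sum (ρ G)) (ρ G i) ⟩
      fromℕ n + sum (ρ G) * deg G i - fromℕ 2 * (deg G i * ρ G i)
        ≡⟨ cong (λ z → fromℕ n + sum (ρ G) * deg G i - fromℕ 2 * z) (deg-*-ρ≡1 i) ⟩
      fromℕ n + sum (ρ G) * deg G i - fromℕ 2 * 1ℚ
        ≡⟨ solve 2 (λ m z → m :+ z :- con (fromℕ 2) :* con 1ℚ :=
             (m :- con (fromℕ 2)) :* con 1ℚ :+ z) refl (fromℕ n) (sum (ρ G) * deg G i) ⟩
      (fromℕ n - fromℕ 2) * 1ℚ + sum (ρ G) * deg G i ∎
      where open ≡-Reasoning

    sum-h : ∑[ i < n ] ∑[ j < n ] h i j ≡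
            (fromℕ n - fromℕ 2) * fromℕ n + sum (ρ G) * (fromℕ 2 * fromℕ ∣E∣)
    sum-h = trans (sum-cong-≗ sum-h-row)
      (trans (sum-linear (fromℕ n - fromℕ 2) (sum (ρ G)) (λ _ → 1ℚ) (deg G))
        (cong₂ (λ y z → (fromℕ n - fromℕ 2) * y + sum (ρ G) * z) (sum-1 n) (sym (handshake G))))

    -- There are no loops, so each diagonal entry is `1 + 1`. Removing the diagonal lowers
    -- `N (N - 2)` to `N (N - 4)`.
    sum-h-diagonal : ∑[ i < n ] h i i ≡ fromℕ 2 * fromℕ n
    sum-h-diagonal = trans
      (sum-cong-≗ λ i → trans
        (cong₂ (λ y z → 1ℚ + y - fromℕ 2 * (z * ρ G i)) (deg-*-ρ≡1 i) (conductance-irrefl G i))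
        (solve 1 (λ x → con 1ℚ :+ con 1ℚ :- con (fromℕ 2) :* (con 0ℚ :* x) :=
                        con (fromℕ 2) :* con 1ℚ) refl (ρ G i)))
      (trans (sym (*-distribˡ-sum {n} (fromℕ 2) (λ _ → 1ℚ))) (cong (fromℕ 2 *_) (sum-1 n)))

    additiveDegreeKirchhoff≥ :
      fromℕ n * (fromℕ n - fromℕ 4) + fromℕ 2 * fromℕ ∣E∣ * sum (ρ G) ≤
      additiveDegreeKirchhoff G conn
    additiveDegreeKirchhoff≥ = begin
      fromℕ n * (fromℕ n - fromℕ 4) + fromℕ 2 * fromℕ ∣E∣ * sum (ρ G)
        ≡⟨ solve 3 (λ m p e →
             m :* (m :- con (fromℕ 4)) :+ e :* p :=
             ((m :- con (fromℕ 2)) :* m :+ p :* e) :- con (fromℕ 2) :* m)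
             refl (fromℕ n) (sum (ρ G)) (fromℕ 2 * fromℕ ∣E∣) ⟩
      ((fromℕ n - fromℕ 2) * fromℕ n + sum (ρ G) * (fromℕ 2 * fromℕ ∣E∣)) - fromℕ 2 * fromℕ n
        ≡⟨ cong₂ _-_ (trans (sum-upperTriangle h) sum-h) sum-h-diagonal ⟨
      (upper + ∑[ i < n ] h i i) - ∑[ i < n ] h i i
        ≡⟨ solve 2 (λ u t → u :+ t :- t := u) refl upper (∑[ i < n ] h i i) ⟩
      upper
        ≤⟨ sum-mono (λ i → sum-mono λ j → term i j) ⟩
      additiveDegreeKirchhoff G conn ∎
      where
      open ≤-Reasoning
      upper = ∑[ i < n ] ∑[ j < n ] (χ i j * (h i j + h j i))
      term : ∀ i j → χ i j * (h i j + h j i) ≤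
        χ i j * (fromℕ (degree i ℕ.+ degree j) * effectiveResistance G conn i j)
      term i j with i <? j
      ... | yes i<j = *-monoˡ-≤-nonNeg 1ℚ (h-sym≤ i j λ i≡j → <ᶠ-irrefl i≡j i<j)
      ... | no _    = ≤-reflexive (trans (*-zeroˡ (h i j + h j i)) (sym (*-zeroˡ
                        (fromℕ (degree i ℕ.+ degree j) * effectiveResistance G conn i j))))

-- Small graphs and passage to the degree sequence

theorem1 : ∀ (N : ℕ) (G : SimpleGraph N) (conn : SimpleGraph.Connected G)
    (d : Fin N → ℕ) → SimpleGraph.IsDegreeSequence G d →
    additiveDegreeKirchhoff G conn
    ≥ fromℕ N * (fromℕ N - fromℕ 4)
    + fromℕ 2 * fromℕ (SimpleGraph.∣E∣ G) * (∑[ j < N ] reciprocal (d j))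
theorem1 zero G conn d _ = ≤-refl
-- A single vertex has degree 0, so `deg-*-ρ≡1` fails here. With no edges the reciprocal sum is
-- multiplied by 0, and the bound is `1 * (1 - 4)`, below the index 0.
theorem1 (suc zero) G conn d _ = begin
  fromℕ 1 * (fromℕ 1 - fromℕ 4) + 0ℚ * s  ≡⟨ cong (fromℕ 1 * (fromℕ 1 - fromℕ 4) +_) (*-zeroˡ s) ⟩
  fromℕ 1 * (fromℕ 1 - fromℕ 4) + 0ℚ      ≤⟨ nonPositive⁻¹ _ ⟩
  0ℚ                                      ≡⟨ cong (λ z → z + 0ℚ + 0ℚ) (*-zeroˡ r) ⟨
  0ℚ * r + 0ℚ + 0ℚ                        ∎
  where
  open ≤-Reasoning
  open SimpleGraph G
  s = ∑[ j < 1 ] reciprocal (d j)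
  r = fromℕ (degree zero ℕ.+ degree zero) * effectiveResistance G conn zero zero
theorem1 (suc (suc n)) G conn d (_ , π , d≡) = subst
  (λ s → fromℕ N * (fromℕ N - fromℕ 4) + fromℕ 2 * fromℕ (SimpleGraph.∣E∣ G) * s
         ≤ additiveDegreeKirchhoff G conn)
  -- The sequence `d` lists the vertex degrees in the order given by `π`, so the sum of reciprocals
  -- is unchanged.
  (trans (∑-permute (ρ G) π) (sum-cong-≗ (sym ∘ cong reciprocal ∘ d≡)))
  -- With at least two vertices each vertex has another to be connected to, hence positive degree.
  (additiveDegreeKirchhoff≥ G conn λ i → deg-*-ρ G conn (≢-other i))
  where
  N = suc (suc n)
  other : Fin N → Fin N
  other zero    = suc zero
  other (suc _) = zero
  ≢-other : ∀ i → i ≢ other i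
  ≢-other zero    ()
  ≢-other (suc _) ()
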